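{- Any linear decision list computing $\mathsf{MAJ}_n\circ\mathsf{XOR}$ must have size $2^{\Omega(n)}$. That is, there exist a constant $c>0$ and an integer $n_0$ such that for every $n\ge n_0$, every linear decision list computing the function $\mathsf{MAJ}_n\circ\mathsf{XOR}:\{0,1\}^n\times\{0,1\}^n\to\{0,1\}$ has size at least $2^{cn}$.
   Context: Define $\mathrm{sign}:\mathbb{R}\to\{0,1\}$ by $\mathrm{sign}(x)=1$ if $x>0$ and $\mathrm{sign}(x)=0$ if $x\le 0$. A function $f:\{0,1\}^N\to\{0,1\}$ is a linear threshold function (LTF) if there are real numbers $w_0,w_1,\dots,w_N$ with $f(x)=\mathrm{sign}(w_0+\sum_{i=1}^N w_ix_i)$ for all $x$. A linear decision list of size $k$ on $N$ variables is a sequence $(L_1,a_1),\dots,(L_k,a_k)$ where each $a_i\in\{0,1\}$, each $L_i$ is an LTF on $\{0,1\}^N$ (arbitrary real weights), and $L_k$ is the constant function $1$. It computes the function $f$ given by $f(x)=a_i$, where $i$ is the least index with $L_i(x)=1$. $\mathsf{MAJ}_n:\{0,1\}^n\to\{0,1\}$ is $\mathsf{MAJ}_n(x)=\mathrm{sign}(x_1+\dots+x_n-n/2)$. For $f:\{0,1\}^n\to\{0,1\}$, $f\circ\mathsf{XOR}:\{0,1\}^n\times\{0,1\}^n\to\{0,1\}$ is $f\circ\mathsf{XOR}(x,y)=f(x_1\oplus y_1,\dots,x_n\oplus y_n)$, viewed as a function of $2n$ Boolean variables. -}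

module Defs where

open import Algebra.Bundles using (CommutativeMonoid)
import Algebra.Properties.CommutativeSemigroup as CommutativeSemigroupProperties
open import Data.Bool using (Bool; true; false; if_then_else_; _xor_)
open import Data.Fin as Fin using (Fin; fromℕ)
open import Data.Integer as ℤ using (+_; -[1+_])
open import Data.Nat as ℕ using (ℕ; suc)
import Data.Nat.Properties as ℕ
open import Data.Product using (∃-syntax; Σ-syntax; _×_; _,_)
open import Data.Rational
  using (ℚ; 0ℚ; ½; _+_; _*_; _-_; -_; ∣_∣; _<_; _/_; ↥_; ↧ₙ_; positive)
open import Data.Rational.Properties
  using ( _<?_; module ≤-Reasoning; <-dense; <-trans
        ; +-mono-<; +-inverseʳ; ∣p+q∣≤∣p∣+∣q∣; *-distribʳ-+; *-identityˡ
        ; neg-distrib-+; +-0-commutativeMonoid; pos*pos⇒pos; positive⁻¹ )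
open import Data.Vec as Vec using (Vec; zipWith; foldr′; take; drop)
open import Relation.Binary.PropositionalEquality
  using (_≡_; refl; sym; trans; cong; subst)
open import Relation.Nullary using (¬_; yes; no)
open import Relation.Nullary.Decidable using (⌊_⌋)

-- Real numbers are rational Cauchy sequences.  Representatives are not
-- identified: only the sign of a real is ever used, and the sign depends only
-- on the class of the sequence modulo null sequences.

IsCauchy : (ℕ → ℚ) → Set
IsCauchy s = ∀ ε → 0ℚ < ε →
  ∃[ N ] (∀ m n → N ℕ.≤ m → N ℕ.≤ n → ∣ s m - s n ∣ < ε)

record ℝ : Set where
  constructor mkℝ
  field
    seq    : ℕ → ℚ
    cauchy : IsCauchy seq

open ℝ public

private
  ½*-pos : ∀ ε → 0ℚ < ε → 0ℚ < ½ * ε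
  ½*-pos ε 0<ε = positive⁻¹ (½ * ε) {{pos*pos⇒pos ½ ε {{positive 0<ε}}}}

  halves : ∀ ε → ½ * ε + ½ * ε ≡ ε
  halves ε = trans (sym (*-distribʳ-+ ε ½ ½)) (*-identityˡ ε)

  interchange : ∀ a b c d → (a + b) - (c + d) ≡ (a - c) + (b - d)
  interchange a b c d =
    trans (cong (λ z → (a + b) + z) (neg-distrib-+ c d)) (+-interchange a b (- c) (- d))
    where
    open CommutativeSemigroupProperties
      (CommutativeMonoid.commutativeSemigroup +-0-commutativeMonoid)
      renaming (interchange to +-interchange)

  +-close : ∀ a b c d ε → ∣ a - c ∣ < ½ * ε → ∣ b - d ∣ < ½ * ε →
            ∣ (a + b) - (c + d) ∣ < ε
  +-close a b c d ε a≈c b≈d = begin-strict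
    ∣ (a + b) - (c + d) ∣    ≡⟨ cong ∣_∣ (interchange a b c d) ⟩
    ∣ (a - c) + (b - d) ∣    ≤⟨ ∣p+q∣≤∣p∣+∣q∣ (a - c) (b - d) ⟩
    ∣ a - c ∣ + ∣ b - d ∣    <⟨ +-mono-< a≈c b≈d ⟩
    ½ * ε + ½ * ε            ≡⟨ halves ε ⟩
    ε                        ∎
    where open ≤-Reasoning

-- Abstract only for efficiency: unfolding these proofs makes typechecking blow up.
abstract
  const-cauchy : ∀ q → IsCauchy (λ _ → q)
  const-cauchy q ε 0<ε =
    0 , λ _ _ _ _ → subst (_< ε) (sym (cong ∣_∣ (+-inverseʳ q))) 0<ε

  +-cauchy : ∀ s t → IsCauchy s → IsCauchy t → IsCauchy (λ n → s n + t n)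
  +-cauchy s t s-cau t-cau ε 0<ε
    with s-cau (½ * ε) (½*-pos ε 0<ε) | t-cau (½ * ε) (½*-pos ε 0<ε)
  ... | M , p | N , q = M ℕ.⊔ N , λ m n M⊔N≤m M⊔N≤n →
    +-close (s m) (t m) (s n) (t n) ε
      (p m n (ℕ.m⊔n≤o⇒m≤o M N M⊔N≤m) (ℕ.m⊔n≤o⇒m≤o M N M⊔N≤n))
      (q m n (ℕ.m⊔n≤o⇒n≤o M N M⊔N≤m) (ℕ.m⊔n≤o⇒n≤o M N M⊔N≤n))

fromℚ : ℚ → ℝ
fromℚ q = mkℝ (λ _ → q) (const-cauchy q)

infixl 6 _+ℝ_

_+ℝ_ : ℝ → ℝ → ℝ
x +ℝ y = mkℝ (λ n → seq x n + seq y n) (+-cauchy (seq x) (seq y) (cauchy x) (cauchy y))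

0<ℝ_ : ℝ → Set
0<ℝ x = ∃[ ε ] (0ℚ < ε × ∃[ N ] (∀ n → N ℕ.≤ n → ε < seq x n))

-- On ℝ the sign is given by its graph, since it is not a computable function:
-- SignIs x b means sign(x) = b.
SignIs : ℝ → Bool → Set
SignIs x true  = 0<ℝ x
SignIs x false = ¬ (0<ℝ x)

signℚ : ℚ → Bool
signℚ q = ⌊ 0ℚ <? q ⌋

signℚ-correct : ∀ q → SignIs (fromℚ q) (signℚ q)
signℚ-correct q with 0ℚ <? q
... | yes 0<q = let ε , 0<ε , ε<q = <-dense 0<q in ε , 0<ε , 0 , λ _ _ → ε<q
... | no  0≮q = λ (_ , 0<ε , N , ε<q) → 0≮q (<-trans 0<ε (ε<q N ℕ.≤-refl))

-- w · b is the product of the real w with the bit b ∈ {0,1}.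
_·_ : ℝ → Bool → ℝ
w · b = if b then w else fromℚ 0ℚ

affine : ∀ {N} → ℝ → Vec ℝ N → Vec Bool N → ℝ
affine w₀ w x = w₀ +ℝ foldr′ _+ℝ_ (fromℚ 0ℚ) (zipWith _·_ w x)

IsLTF : ∀ {N} → (Vec Bool N → Bool) → Set
IsLTF {N} f = Σ[ w₀ ∈ ℝ ] Σ[ w ∈ Vec ℝ N ] (∀ x → SignIs (affine w₀ w x) (f x))

record LTF (N : ℕ) : Set where
  field
    eval  : Vec Bool N → Bool
    isLTF : IsLTF eval

open LTF public

-- The size is at least 1 because the last query has to exist.
record LinearDecisionList (N : ℕ) : Set where
  field
    size-1     : ℕ
    query      : Fin (suc size-1) → LTF N
    answer     : Fin (suc size-1) → Bool
    last-const : ∀ x → eval (query (fromℕ size-1)) x ≡ true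

  size : ℕ
  size = suc size-1

open LinearDecisionList public

FirstTrue : ∀ {N} (D : LinearDecisionList N) → Vec Bool N → Fin (size D) → Set
FirstTrue D x i =
  eval (query D i) x ≡ true × (∀ j → j Fin.< i → eval (query D j) x ≡ false)

Computes : ∀ {N} → LinearDecisionList N → (Vec Bool N → Bool) → Set
Computes D f = ∀ x → ∃[ i ] (FirstTrue D x i × f x ≡ answer D i)

bit : Bool → ℕ
bit b = if b then 1 else 0

MAJ : ∀ n → Vec Bool n → Bool
MAJ n x = signℚ ((+ Vec.sum (Vec.map bit x)) / 1 - (+ n) / 2)

_∘XOR : ∀ {n} → (Vec Bool n → Bool) → Vec Bool n → Vec Bool n → Bool
(f ∘XOR) x y = f (zipWith _xor_ x y)

joined : ∀ {n} → (Vec Bool n → Vec Bool n → Bool) → Vec Bool (n ℕ.+ n) → Bool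
joined {n} F z = F (take n z) (drop n z)

-- 2^ r ≤ m is the inequality between the real power 2^r and m, for rational
-- r = p/q with q > 0: raising both sides to the power q gives 2^p ≤ m^q, and 2^p is moved to the
-- other side when p is negative.
infix 4 2^_≤_

2^_≤_ : ℚ → ℕ → Set
2^ r ≤ m with ↥ r
... | + p      = 2 ℕ.^ p ℕ.≤ m ℕ.^ ↧ₙ r
... | -[1+ p ] = 1 ℕ.≤ 2 ℕ.^ suc p ℕ.* m ℕ.^ ↧ₙ r

module Submission where

-- An LTF of (x , y) is 1 exactly when a(x) + b(y) > 0, so the rows of its matrix are
-- nested.  From a nested matrix on A × B one can either cut out a rectangle of ones whose
-- sides have at least 2ⁿ/k elements, or delete fewer than 2ⁿ/k rows and columns and be left with
-- zeros.  Running through the k queries of a decision list, the deletions never exhaust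
-- the cube, so the computed function is constant on a rectangle with sides of at least 2ⁿ/k elements.
-- For MAJ ∘ XOR (after replacing y by its antipode if the value is 0) all distances
-- in that rectangle are at least n/2, which by an isoperimetric inequality,
-- |A||B| ≤ (9/2)ⁿ 2^(−t) if all distances are at least t, forces 2ⁿ ≤ k⁸.

open import Defs
open import Algebra.Bundles using (CommutativeMonoid)
open import Data.Bool using (Bool; true; false; not; _∧_; _xor_)
open import Data.Bool.Properties using (∧-conicalˡ; ∧-conicalʳ; ∧-identityʳ; ∧-zeroʳ)
open import Data.Empty using (⊥; ⊥-elim)
open import Data.Fin as Fin using (Fin; fromℕ)
import Data.Fin.Properties as Fin
open import Data.Nat using (ℕ; zero; suc; _≥_) renaming (_+_ to _+ℕ_)
import Data.Nat as ℕ
import Data.Nat.Properties as ℕ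
open import Data.Product using (Σ-syntax; ∃-syntax; _×_; _,_)
open import Data.Sum using (_⊎_; inj₁; inj₂; reduce)
open import Data.Vec as Vec using (Vec; []; _∷_; map; zipWith; _++_; foldr′; take; drop)
open import Data.Vec.Properties using (take++drop≡id; ++-injective)
open import Function using (_∘_; flip)
open import Relation.Binary.Core using (Rel)
open import Relation.Binary.Definitions using (Total; Transitive; tri<; tri≈; tri>)
open import Relation.Binary.PropositionalEquality
open import Relation.Nullary using (¬_; Dec; yes; no; contradiction)
open import Relation.Nullary.Decidable using (⌊_⌋)

private
  variable
    n : ℕ

⌊⌋-true : ∀ {P : Set} (P? : Dec P) → ⌊ P? ⌋ ≡ true → P
⌊⌋-true (yes p) _ = p

⌊⌋-false : ∀ {P : Set} (P? : Dec P) → ⌊ P? ⌋ ≡ false → ¬ P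
⌊⌋-false (no ¬p) _ = ¬p

not-true : ∀ {b} → not b ≡ true → b ≡ false
not-true {false} _ = refl

module Hypercube where

  open import Data.Nat
    using (_+_; _*_; _∸_; _^_; _≤_; _<_; z≤n; s≤s; _≤?_; >-nonZero; ⌈_/2⌉)
  open import Data.Nat.Properties
  open import Data.Nat.Tactic.RingSolver using (solve-∀)

  -- Subsets of the cube and their sizes.

  Subset : ℕ → Set
  Subset n = Vec Bool n → Bool

  infix 4 _∈_ _⊆_
  infixl 6 _∩_ _∖_

  _∈_ : Vec Bool n → Subset n → Set
  x ∈ A = A x ≡ true

  _⊆_ : Subset n → Subset n → Set
  A ⊆ B = ∀ x → x ∈ A → x ∈ B

  _∩_ _∖_ : Subset n → Subset n → Subset n
  (A ∩ B) x = A x ∧ B x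
  (A ∖ B) x = A x ∧ not (B x)

  ∩-⊆ˡ : ∀ (A B : Subset n) → A ∩ B ⊆ A
  ∩-⊆ˡ A B x = ∧-conicalˡ (A x) (B x)

  ∩-⊆ʳ : ∀ (A B : Subset n) → A ∩ B ⊆ B
  ∩-⊆ʳ A B x = ∧-conicalʳ (A x) (B x)

  ∖-⊆ : ∀ (A B : Subset n) → A ∖ B ⊆ A
  ∖-⊆ A B x = ∧-conicalˡ (A x) (not (B x))

  ∖-∉ : ∀ (A B : Subset n) x → x ∈ A ∖ B → B x ≡ false
  ∖-∉ A B x x∈ = not-true (∧-conicalʳ (A x) (not (B x)) x∈)

  count : Subset n → ℕ
  count {zero}  A = bit (A [])
  count {suc n} A = count (A ∘ (false ∷_)) + count (A ∘ (true ∷_))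

  count-full : ∀ n → count {n} (λ _ → true) ≡ 2 ^ n
  count-full zero    = refl
  count-full (suc n) rewrite count-full n = cong (2 ^ n +_) (sym (+-identityʳ (2 ^ n)))

  count-mono : ∀ (A B : Subset n) → A ⊆ B → count A ≤ count B
  count-mono {zero} A B A⊆B with A [] | A⊆B []
  ... | false | _  = z≤n
  ... | true  | ∈B rewrite ∈B refl = ≤-refl
  count-mono {suc n} A B A⊆B =
    +-mono-≤ (count-mono _ _ (λ x → A⊆B (false ∷ x))) (count-mono _ _ (λ x → A⊆B (true ∷ x)))

  count-mono-< : ∀ (A B : Subset n) → A ⊆ B → ∀ x → x ∈ B → A x ≡ false → count A < count B
  count-mono-< {zero} A B A⊆B [] ∈B ∉A rewrite ∈B | ∉A = ≤-refl
  count-mono-< {suc n} A B A⊆B (false ∷ x) ∈B ∉A =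
    +-mono-<-≤ (count-mono-< _ _ (λ y → A⊆B (false ∷ y)) x ∈B ∉A) (count-mono _ _ (λ y → A⊆B (true ∷ y)))
  count-mono-< {suc n} A B A⊆B (true ∷ x) ∈B ∉A =
    +-mono-≤-< (count-mono _ _ (λ y → A⊆B (false ∷ y))) (count-mono-< _ _ (λ y → A⊆B (true ∷ y)) x ∈B ∉A)

  count-split : ∀ (A B : Subset n) → count A ≡ count (A ∩ B) + count (A ∖ B)
  count-split {zero} A B with A [] | B []
  ... | false | _     = refl
  ... | true  | false = refl
  ... | true  | true  = refl
  count-split {suc n} A B
    rewrite count-split (A ∘ (false ∷_)) (B ∘ (false ∷_))
          | count-split (A ∘ (true ∷_)) (B ∘ (true ∷_))
    = interchange (count ((A ∘ (false ∷_)) ∩ (B ∘ (false ∷_)))) _ _ _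
    where
    interchange : ∀ a b c d → (a + b) + (c + d) ≡ (a + c) + (b + d)
    interchange = solve-∀

  -- Sizes are multiplied by k so that N is never divided by it. With N on the right, a deletion is
  -- charged as one N, which can be cancelled later.
  count-removal : ∀ k {N} (A B : Subset n) → k * count (A ∩ B) ≤ N →
                  k * count A ≤ N + k * count (A ∖ B)
  count-removal k A B small
    rewrite count-split A B | *-distribˡ-+ k (count (A ∩ B)) (count (A ∖ B)) = +-monoˡ-≤ _ small

  count-antipodal : ∀ (A : Subset n) → count (A ∘ map not) ≡ count A
  count-antipodal {zero} A = refl
  count-antipodal {suc n} A
    rewrite count-antipodal (A ∘ (true ∷_)) | count-antipodal (A ∘ (false ∷_)) =
    +-comm (count (A ∘ (true ∷_))) _

  -- Serves to pick the lightest heavy row and, with the order reversed, the heaviest light row. The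
  -- recursion compares the winners of the two half-cubes, so ties under `≼` do no harm.
  least : ∀ {ℓ} {_≼_ : Rel (Vec Bool n) ℓ} → Total _≼_ → Transitive _≼_ → (A : Subset n) →
          (∃[ x ] (x ∈ A × (∀ y → y ∈ A → x ≼ y))) ⊎ (∀ x → A x ≡ false)
  least {zero} total _ A with A [] in eq
  ... | false = inj₂ λ { [] → eq }
  ... | true  = inj₁ ([] , eq , λ { [] _ → reduce (total [] []) })
  least {suc n} {_≼_ = _≼_} total trans≼ A
    with least {_≼_ = λ x y → (false ∷ x) ≼ (false ∷ y)} (λ x y → total _ _) trans≼ (A ∘ (false ∷_))
       | least {_≼_ = λ x y → (true ∷ x) ≼ (true ∷ y)} (λ x y → total _ _) trans≼ (A ∘ (true ∷_))
  ... | inj₂ ∅₀ | inj₂ ∅₁ = inj₂ λ { (false ∷ x) → ∅₀ x ; (true ∷ x) → ∅₁ x }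
  ... | inj₁ (x , x∈ , x≼) | inj₂ ∅₁ = inj₁ (false ∷ x , x∈ , λ
    { (false ∷ y) y∈ → x≼ y y∈
    ; (true  ∷ y) y∈ → contradiction (trans (sym y∈) (∅₁ y)) λ () })
  ... | inj₂ ∅₀ | inj₁ (x , x∈ , x≼) = inj₁ (true ∷ x , x∈ , λ
    { (false ∷ y) y∈ → contradiction (trans (sym y∈) (∅₀ y)) λ ()
    ; (true  ∷ y) y∈ → x≼ y y∈ })
  ... | inj₁ (x , x∈ , x≼) | inj₁ (x′ , x′∈ , x′≼) with total (false ∷ x) (true ∷ x′)
  ...   | inj₁ x≼x′ = inj₁ (false ∷ x , x∈ , λ
    { (false ∷ y) y∈ → x≼ y y∈ ; (true ∷ y) y∈ → trans≼ x≼x′ (x′≼ y y∈) })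
  ...   | inj₂ x′≼x = inj₁ (true ∷ x′ , x′∈ , λ
    { (false ∷ y) y∈ → trans≼ x′≼x (x≼ y y∈) ; (true ∷ y) y∈ → x′≼ y y∈ })

  -- Nested matrices and constant rectangles.

  Matrix : ℕ → Set
  Matrix n = Vec Bool n → Vec Bool n → Bool

  Constant : Matrix n → Bool → Subset n → Subset n → Set
  Constant M b A B = ∀ x y → x ∈ A → y ∈ B → M x y ≡ b

  -- No 2×2 submatrix is a permutation matrix; equivalently the rows are nested.
  Ferrers : Matrix n → Set
  Ferrers M = ∀ x x′ y y′ →
    M x y ≡ true → M x′ y′ ≡ true → M x y′ ≡ false → M x′ y ≡ false → ⊥

  degree : Matrix n → Subset n → Vec Bool n → ℕ
  degree M B x = count (B ∩ M x)

  -- If some y of B lay in row x but not in row x′, nestedness would put row x′ inside row x within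
  -- B, strictly because of y, so x′ would have the smaller degree.
  degree-nested : ∀ {M : Matrix n} → Ferrers M → ∀ B x x′ →
                  degree M B x ≤ degree M B x′ → B ∩ M x ⊆ M x′
  degree-nested {M = M} ferrers B x x′ d≤d′ y y∈ with M x′ y in x′y
  ... | true  = refl
  ... | false = contradiction d≤d′ (<⇒≱ (count-mono-< _ _ row⊆ y y∈ y∉))
    where
    y∉ : (B ∩ M x′) y ≡ false
    y∉ rewrite x′y = ∧-zeroʳ (B y)
    row⊆ : B ∩ M x′ ⊆ B ∩ M x
    row⊆ z z∈ with M x z in xz
    ... | true  = trans (∧-identityʳ (B z)) (∩-⊆ˡ B (M x′) z z∈)
    ... | false = ⊥-elim (ferrers x x′ y z (∩-⊆ʳ B (M x) y y∈) (∩-⊆ʳ B (M x′) z z∈) xz x′y)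

  module _ {M : Matrix n} (ferrers : Ferrers M) (k N : ℕ) (A B : Subset n) where

    private
      deg : Vec Bool n → ℕ
      deg = degree M B

      heavy : Subset n
      heavy x = ⌊ N ≤? k * deg x ⌋

    -- The rows are split by whether their degree reaches N / k.  If at least
    -- N / k rows are heavy, the lightest of them spans a rectangle of ones;
    -- otherwise delete the heavy rows and the neighbourhood of the heaviest light row.
    peel : N ≤ k * count B →
           (Σ[ A′ ∈ Subset n ] Σ[ B′ ∈ Subset n ]
             (A′ ⊆ A × B′ ⊆ B × N ≤ k * count A′ × N ≤ k * count B′ × Constant M true A′ B′))
         ⊎ (Σ[ A′ ∈ Subset n ] Σ[ B′ ∈ Subset n ]
             (A′ ⊆ A × B′ ⊆ B × k * count A ≤ N + k * count A′ × k * count B ≤ N + k * count B′ ×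
              Constant M false A′ B′))
    peel N≤kB with N ≤? k * count (A ∩ heavy)
    ... | yes many with least (λ x y → ≤-total (deg x) (deg y)) ≤-trans (A ∩ heavy)
    -- Having `many` without any heavy row means N = 0, so an empty side is large enough.
    ...   | inj₂ empty = inj₁ (A ∩ heavy , B , ∩-⊆ˡ A heavy , (λ _ y∈ → y∈) , many , N≤kB ,
              λ x _ x∈ _ → contradiction (trans (sym x∈) (empty x)) λ ())
    ...   | inj₁ (x₀ , x₀∈ , x₀-least) =
              inj₁ (A ∩ heavy , B ∩ M x₀ , ∩-⊆ˡ A heavy , ∩-⊆ˡ B (M x₀) , many ,
                ⌊⌋-true (N ≤? _) (∩-⊆ʳ A heavy x₀ x₀∈) ,
                λ x y x∈ y∈ → degree-nested ferrers B x₀ x (x₀-least x x∈) y y∈)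
    peel N≤kB | no few with least (λ x y → ≤-total (deg y) (deg x)) (flip ≤-trans) (A ∖ heavy)
    ...   | inj₂ empty = inj₂ (A ∖ heavy , B , ∖-⊆ A heavy , (λ _ y∈ → y∈) ,
              count-removal k A heavy (<⇒≤ (≰⇒> few)) , m≤n+m _ N ,
              λ x _ x∈ _ → contradiction (trans (sym x∈) (empty x)) λ ())
    ...   | inj₁ (x₀ , x₀∈ , x₀-greatest) =
              inj₂ (A ∖ heavy , B ∖ M x₀ , ∖-⊆ A heavy , ∖-⊆ B (M x₀) ,
                count-removal k A heavy (<⇒≤ (≰⇒> few)) ,
                count-removal k B (M x₀) (<⇒≤ (≰⇒> (⌊⌋-false (N ≤? _) (∖-∉ A heavy x₀ x₀∈)))) ,
                zeros)
      where
      zeros : Constant M false (A ∖ heavy) (B ∖ M x₀)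
      zeros x y x∈ y∈ with M x y in xy
      ... | false = refl
      -- A one at (x , y) would put y into row x₀, which within B contains every row of smaller or
      -- equal degree; but the columns of row x₀ were deleted.
      ... | true  = contradiction
        (trans (sym (degree-nested ferrers B x x₀ (x₀-greatest x x∈) y
                       (cong₂ _∧_ (∖-⊆ B (M x₀) y y∈) xy)))
               (∖-∉ B (M x₀) y y∈)) λ ()

  FirstQueryRectangle : ∀ m → (Fin (suc m) → Matrix n) → ℕ → ℕ → Subset n → Subset n → Set
  FirstQueryRectangle {n} m M k N A B =
    Σ[ i ∈ Fin (suc m) ] Σ[ A′ ∈ Subset n ] Σ[ B′ ∈ Subset n ]
      (A′ ⊆ A × B′ ⊆ B × N ≤ k * count A′ × N ≤ k * count B′ ×
       Constant (M i) true A′ B′ × (∀ j → j Fin.< i → Constant (M j) false A′ B′))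

  -- Induction over the queries. A query that yields no rectangle of ones costs at most one N on
  -- each side, so the initial `suc m * N` leaves at least N for the last query, which is constantly
  -- true.
  first-query-rectangle :
    ∀ m (M : Fin (suc m) → Matrix n) → (∀ i → Ferrers (M i)) →
    (∀ x y → M (fromℕ m) x y ≡ true) → ∀ k N (A B : Subset n) →
    suc m * N ≤ k * count A → suc m * N ≤ k * count B →
    FirstQueryRectangle m M k N A B
  first-query-rectangle zero M _ last k N A B N≤A N≤B =
    Fin.zero , A , B , (λ _ x∈ → x∈) , (λ _ y∈ → y∈) , subst (_≤ k * count A) (+-identityʳ N) N≤A ,
    subst (_≤ k * count B) (+-identityʳ N) N≤B , (λ x y _ _ → last x y) , λ _ ()
  first-query-rectangle (suc m) M ferrers last k N A B N≤A N≤B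
    with peel (ferrers Fin.zero) k N A B (m+n≤o⇒m≤o N N≤B)
  ... | inj₁ (A′ , B′ , A′⊆A , B′⊆B , N≤A′ , N≤B′ , ones) =
    Fin.zero , A′ , B′ , A′⊆A , B′⊆B , N≤A′ , N≤B′ , ones , λ _ ()
  ... | inj₂ (A′ , B′ , A′⊆A , B′⊆B , A≤A′ , B≤B′ , zeros)
    with first-query-rectangle m (M ∘ Fin.suc) (ferrers ∘ Fin.suc) last k N A′ B′
           (+-cancelˡ-≤ N _ _ (≤-trans N≤A A≤A′)) (+-cancelˡ-≤ N _ _ (≤-trans N≤B B≤B′))
  ... | i , A″ , B″ , A″⊆A′ , B″⊆B′ , N≤A″ , N≤B″ , ones , earlier =
    Fin.suc i , A″ , B″ , (λ x → A′⊆A x ∘ A″⊆A′ x) , (λ y → B′⊆B y ∘ B″⊆B′ y) ,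
    N≤A″ , N≤B″ , ones , λ where
      Fin.zero    _         x y x∈ y∈ → zeros x y (A″⊆A′ x x∈) (B″⊆B′ y y∈)
      (Fin.suc j) (s≤s j<i) x y x∈ y∈ → earlier j j<i x y x∈ y∈

  -- Hamming distance and the isoperimetric inequality.

  dist : Vec Bool n → Vec Bool n → ℕ
  dist x y = Vec.sum (map bit (zipWith _xor_ x y))

  dist-antipodal : ∀ (x y : Vec Bool n) → dist x y + dist x (map not y) ≡ n
  dist-antipodal [] [] = refl
  dist-antipodal (false ∷ x) (false ∷ y) =
    trans (+-suc _ _) (cong suc (dist-antipodal x y))
  dist-antipodal (false ∷ x) (true  ∷ y) = cong suc (dist-antipodal x y)
  dist-antipodal (true  ∷ x) (false ∷ y) = cong suc (dist-antipodal x y)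
  dist-antipodal (true  ∷ x) (true  ∷ y) =
    trans (+-suc _ _) (cong suc (dist-antipodal x y))

  -- The sum is at most 2K unless K < x ≤ 2K, and then (2K − x)(x − K/2) ≥ 0
  -- says that x + K²/x ≤ 5K/2, where y ≤ K²/x.
  ordered-sum≤5/2 : ∀ K x y → y ≤ x → x ≤ 2 * K → x * y ≤ K * K → 2 * (x + y) ≤ 5 * K
  ordered-sum≤5/2 K x y y≤x x≤2K xy≤K² with ≤-<-connex x K
  ... | inj₁ x≤K = begin
    2 * (x + y)  ≤⟨ *-monoʳ-≤ 2 (+-mono-≤ x≤K (≤-trans y≤x x≤K)) ⟩
    2 * (K + K)  ≡⟨ double K ⟩
    4 * K        ≤⟨ *-monoˡ-≤ K (n≤1+n 4) ⟩
    5 * K        ∎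
    where
    open ≤-Reasoning
    double : ∀ K → 2 * (K + K) ≡ 4 * K
    double = solve-∀
  ... | inj₂ K<x with m≤n⇒∃[o]m+o≡n (<⇒≤ K<x) | m≤n⇒∃[o]m+o≡n x≤2K
  -- Here d = x - K and e = 2K - x, hence K = d + e and x = d + e + d: everything becomes a
  -- polynomial in d and e without subtraction.
  ...   | d , refl | e , x+e≡2K with +-cancelˡ-≡ K (d + e) K
            (trans (sym (+-assoc K d e)) (trans x+e≡2K (cong (K +_) (+-identityʳ K))))
  ...     | refl = *-cancelˡ-≤ x {{>-nonZero (≤-<-trans z≤n K<x)}} (begin
    x * (2 * (x + y))                    ≡⟨ expand x y ⟩
    2 * (x * x) + 2 * (x * y)            ≤⟨ +-monoʳ-≤ (2 * (x * x)) (*-monoʳ-≤ 2 xy≤K²) ⟩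
    -- The added slack is (2K - x)(2x - K) = e(3d + e).
    2 * (x * x) + 2 * (K * K)            ≤⟨ m≤m+n _ (3 * (d * e) + e * e) ⟩
    2 * (x * x) + 2 * (K * K) + (3 * (d * e) + e * e) ≡⟨ factor d e ⟩
    x * (5 * K)                          ∎)
    where
    open ≤-Reasoning
    expand : ∀ x y → x * (2 * (x + y)) ≡ 2 * (x * x) + 2 * (x * y)
    expand = solve-∀
    factor : ∀ d e → 2 * ((d + e + d) * (d + e + d)) + 2 * ((d + e) * (d + e)) + (3 * (d * e) + e * e)
                   ≡ (d + e + d) * (5 * (d + e))
    factor = solve-∀

  sum≤5/2 : ∀ K x y → x ≤ 2 * K → y ≤ 2 * K → x * y ≤ K * K → 2 * (x + y) ≤ 5 * K
  sum≤5/2 K x y x≤2K y≤2K xy≤K² with ≤-total y x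
  ... | inj₁ y≤x = ordered-sum≤5/2 K x y y≤x x≤2K xy≤K²
  ... | inj₂ x≤y = subst (λ z → 2 * z ≤ 5 * K) (+-comm y x)
                     (ordered-sum≤5/2 K y x x≤y y≤2K (subst (_≤ K * K) (*-comm x y) xy≤K²))

  Separated : ℕ → Subset n → Subset n → Set
  Separated t A B = ∀ x y → x ∈ A → y ∈ B → t ≤ dist x y

  -- Writing A = A₀ ∪ A₁ and B = B₀ ∪ B₁ by the first coordinate, the products
  -- |A₀||B₁| and |A₁||B₀| of the sets at distance t − 1 satisfy
  -- |A₀||B₁| · |A₁||B₀| = |A₀||B₀| · |A₁||B₁|, so they cannot both attain the weaker bound.
  separated-bound : ∀ t (A B : Subset n) → Separated t A B →
                    count A * count B * (2 ^ t * 2 ^ n) ≤ 9 ^ n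
  separated-bound {zero} t A B sep with A [] in a | B [] in b
  ... | false | _     = z≤n
  ... | true  | false = z≤n
  -- The only pair of points has distance 0, which forces t = 0.
  ... | true  | true  with sep [] [] a b
  ...   | z≤n = ≤-refl
  separated-bound {suc n} t A B sep = begin
    (a₀ + a₁) * (b₀ + b₁) * (2 ^ t * (2 * 2 ^ n))
      ≡⟨ expand a₀ a₁ b₀ b₁ (2 ^ t) (2 ^ n) ⟩
    2 * (a₀ * b₀ * s + a₁ * b₁ * s) + 2 * (a₀ * b₁ * s + a₁ * b₀ * s)
      -- The pairs with equal first coordinate contribute 4K. The other two products are at most 2K
      -- each, but their product is at most K², so they contribute 5K instead of 8K.
      ≤⟨ +-mono-≤ (*-monoʳ-≤ 2 (+-mono-≤ near₀ near₁))
           (sum≤5/2 K _ _ far₀ far₁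
             (subst (_≤ K * K) (regroup a₀ a₁ b₀ b₁ s) (*-mono-≤ near₀ near₁))) ⟩
    2 * (K + K) + 5 * K
      ≡⟨ collect K ⟩
    9 * K ∎
    where
    open ≤-Reasoning
    A₀ A₁ B₀ B₁ : Subset n
    A₀ = A ∘ (false ∷_)
    A₁ = A ∘ (true ∷_)
    B₀ = B ∘ (false ∷_)
    B₁ = B ∘ (true ∷_)
    a₀ a₁ b₀ b₁ s K : ℕ
    a₀ = count A₀
    a₁ = count A₁
    b₀ = count B₀
    b₁ = count B₁
    s = 2 ^ t * 2 ^ n
    K = 9 ^ n
    expand : ∀ a₀ a₁ b₀ b₁ p q → (a₀ + a₁) * (b₀ + b₁) * (p * (2 * q)) ≡
      2 * (a₀ * b₀ * (p * q) + a₁ * b₁ * (p * q)) + 2 * (a₀ * b₁ * (p * q) + a₁ * b₀ * (p * q))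
    expand = solve-∀
    regroup : ∀ a₀ a₁ b₀ b₁ s → a₀ * b₀ * s * (a₁ * b₁ * s) ≡ a₀ * b₁ * s * (a₁ * b₀ * s)
    regroup = solve-∀
    collect : ∀ K → 2 * (K + K) + 5 * K ≡ 9 * K
    collect = solve-∀
    -- Differing first coordinates lower the required distance by one, at the price of a factor 2.
    -- For t = 0 truncated subtraction leaves it at 0, hence an inequality.
    2^-pred : ∀ t → 2 ^ t ≤ 2 * 2 ^ (t ∸ 1)
    2^-pred zero    = s≤s z≤n
    2^-pred (suc t) = ≤-refl
    near₀ : a₀ * b₀ * s ≤ K
    near₀ = separated-bound t A₀ B₀ λ x y → sep (false ∷ x) (false ∷ y)
    near₁ : a₁ * b₁ * s ≤ K
    near₁ = separated-bound t A₁ B₁ λ x y → sep (true ∷ x) (true ∷ y)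
    weaken : ∀ p → p * (2 ^ (t ∸ 1) * 2 ^ n) ≤ K → p * s ≤ 2 * K
    weaken p p≤ = begin
      p * (2 ^ t * 2 ^ n)              ≤⟨ *-monoʳ-≤ p (*-monoˡ-≤ (2 ^ n) (2^-pred t)) ⟩
      p * (2 * 2 ^ (t ∸ 1) * 2 ^ n)    ≡⟨ pull p (2 ^ (t ∸ 1)) (2 ^ n) ⟩
      2 * (p * (2 ^ (t ∸ 1) * 2 ^ n))  ≤⟨ *-monoʳ-≤ 2 p≤ ⟩
      2 * K                            ∎
      where
      pull : ∀ p q r → p * (2 * q * r) ≡ 2 * (p * (q * r))
      pull = solve-∀
    far₀ : a₀ * b₁ * s ≤ 2 * K
    far₀ = weaken (a₀ * b₁) (separated-bound (t ∸ 1) A₀ B₁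
      λ x y x∈ y∈ → ∸-monoˡ-≤ 1 (sep (false ∷ x) (true ∷ y) x∈ y∈))
    far₁ : a₁ * b₀ * s ≤ 2 * K
    far₁ = weaken (a₁ * b₀) (separated-bound (t ∸ 1) A₁ B₀
      λ x y x∈ y∈ → ∸-monoˡ-≤ 1 (sep (true ∷ x) (false ∷ y) x∈ y∈))

  -- From the isoperimetric inequality to the size bound.

  ^-distribʳ-* : ∀ m n k → (m * n) ^ k ≡ m ^ k * n ^ k
  ^-distribʳ-* m n zero    = refl
  ^-distribʳ-* m n (suc k) =
    trans (cong (m * n *_) (^-distribʳ-* m n k)) ([m*n]*[o*p]≡[m*o]*[n*p] m n (m ^ k) (n ^ k))

  ^-swap : ∀ m j k → (m ^ j) ^ k ≡ (m ^ k) ^ j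
  ^-swap m j k =
    trans (^-*-assoc m j k) (trans (cong (m ^_) (*-comm j k)) (sym (^-*-assoc m k j)))

  -- 2 · 9⁴ = 13122 ≤ 16384 = 2¹⁴.
  2·9⁴≤2¹⁴ : ∀ n → 2 ^ n * (9 ^ n) ^ 4 ≤ (2 ^ n) ^ 14
  2·9⁴≤2¹⁴ n = begin
    2 ^ n * (9 ^ n) ^ 4    ≡⟨ cong (2 ^ n *_) (^-swap 9 n 4) ⟩
    2 ^ n * (9 ^ 4) ^ n    ≡⟨ ^-distribʳ-* 2 (9 ^ 4) n ⟨
    (2 * 9 ^ 4) ^ n        ≤⟨ ^-monoˡ-≤ n (m≤m+n (2 * 9 ^ 4) 3262) ⟩
    (2 ^ 14) ^ n           ≡⟨ ^-swap 2 14 n ⟩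
    (2 ^ n) ^ 14           ∎
    where open ≤-Reasoning

  -- Write p = 2ⁿ and q = 9ⁿ. Multiplying the hypotheses gives p⁷ ≤ k⁴(abtp)² ≤ k⁴q². Squaring this
  -- and using p·q⁴ ≤ p¹⁴, the factor q⁴ cancels and p ≤ k⁸ remains.
  power≤size^8 : ∀ n k a b t → 2 ^ n ≤ k * a → 2 ^ n ≤ k * b → 2 ^ n ≤ t * t →
                 a * b * (t * 2 ^ n) ≤ 9 ^ n → 2 ^ n ≤ k ^ 8
  power≤size^8 n k a b t p≤ka p≤kb p≤t² abtp≤q =
    *-cancelʳ-≤ p (k ^ 8) (q ^ 4) {{m^n≢0 q 4 {{m^n≢0 9 n}}}} (begin
      p * q ^ 4                          ≤⟨ 2·9⁴≤2¹⁴ n ⟩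
      p ^ 14                             ≡⟨ ^-distribˡ-+-* p 7 7 ⟩
      p ^ 7 * p ^ 7                      ≤⟨ *-mono-≤ p⁷≤ p⁷≤ ⟩
      (k ^ 4 * q ^ 2) * (k ^ 4 * q ^ 2)  ≡⟨ [m*n]*[o*p]≡[m*o]*[n*p] (k ^ 4) (q ^ 2) (k ^ 4) (q ^ 2) ⟩
      (k ^ 4 * k ^ 4) * (q ^ 2 * q ^ 2)  ≡⟨ cong₂ _*_ (^-distribˡ-+-* k 4 4) (^-distribˡ-+-* q 2 2) ⟨
      k ^ 8 * q ^ 4                      ∎)
    where
    open ≤-Reasoning
    p q : ℕ
    p = 2 ^ n
    q = 9 ^ n
    -- The factors 1 come from unfolding p ^ 7, k ^ 4 and _ ^ 2.
    split : ∀ p → p * (p * (p * (p * (p * (p * (p * 1)))))) ≡ (p * p) * (p * p) * p * (p * p)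
    split = solve-∀
    collect : ∀ k a b t p →
      (k * a * (k * b)) * (k * a * (k * b)) * (t * t) * (p * p) ≡
      k * (k * (k * (k * 1))) * (a * b * (t * p) * (a * b * (t * p) * 1))
    collect = solve-∀
    p²≤ : p * p ≤ k * a * (k * b)
    p²≤ = *-mono-≤ p≤ka p≤kb
    p⁷≤ : p ^ 7 ≤ k ^ 4 * q ^ 2
    p⁷≤ = begin
      p ^ 7                                                      ≡⟨ split p ⟩
      (p * p) * (p * p) * p * (p * p)
        ≤⟨ *-monoˡ-≤ (p * p) (*-mono-≤ (*-mono-≤ p²≤ p²≤) p≤t²) ⟩
      (k * a * (k * b)) * (k * a * (k * b)) * (t * t) * (p * p)  ≡⟨ collect k a b t p ⟩
      k ^ 4 * (a * b * (t * p)) ^ 2                              ≤⟨ *-monoʳ-≤ (k ^ 4) (^-monoˡ-≤ 2 abtp≤q) ⟩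
      k ^ 4 * q ^ 2                                              ∎

  far-rectangle-bound : ∀ n k (A B : Subset n) → 2 ^ n ≤ k * count A → 2 ^ n ≤ k * count B →
                        (∀ x y → x ∈ A → y ∈ B → n ≤ dist x y + dist x y) → 2 ^ n ≤ k ^ 8
  far-rectangle-bound n k A B A-big B-big far =
    power≤size^8 n k (count A) (count B) (2 ^ t) A-big B-big 2^n≤
      (separated-bound t A B λ x y x∈ y∈ →
        subst (t ≤_) (sym (n≡⌈n+n/2⌉ (dist x y))) (⌈n/2⌉-mono (far x y x∈ y∈)))
    where
    -- Rounding up is harmless since distances are integers, and it ensures n ≤ 2t.
    t : ℕ
    t = ⌈ n /2⌉
    2^n≤ : 2 ^ n ≤ 2 ^ t * 2 ^ t
    2^n≤ = subst (2 ^ n ≤_) (^-distribˡ-+-* 2 t t)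
      (^-monoʳ-≤ 2 (subst (_≤ t + t) (⌊n/2⌋+⌈n/2⌉≡n n) (+-monoˡ-≤ t (⌊n/2⌋≤⌈n/2⌉ n))))

  -- The antipodal map preserves `count` and turns distance d into n - d, so applying it to B
  -- reduces this to `far-rectangle-bound`.
  near-rectangle-bound : ∀ n k (A B : Subset n) → 2 ^ n ≤ k * count A → 2 ^ n ≤ k * count B →
                         (∀ x y → x ∈ A → y ∈ B → dist x y + dist x y ≤ n) → 2 ^ n ≤ k ^ 8
  near-rectangle-bound n k A B A-big B-big near =
    far-rectangle-bound n k A (B ∘ map not) A-big
      (subst (λ c → 2 ^ n ≤ k * c) (sym (count-antipodal B)) B-big)
      λ x y x∈ y∈ → opposite (dist x y) (dist x (map not y)) (dist-antipodal x y) (near x (map not y) x∈ y∈)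
    where
    opposite : ∀ d d′ → d + d′ ≡ n → d′ + d′ ≤ n → n ≤ d + d
    opposite d d′ refl d′+d′≤ = +-monoʳ-≤ d (+-cancelʳ-≤ d′ d′ d d′+d′≤)

open Hypercube
open import Data.Integer using (+_; -[1+_])
import Data.Integer as ℤ
import Data.Integer.Properties as ℤ
open import Data.Rational
  using (mkℚ; 0ℚ; ½; _+_; _*_; _-_; -_; ∣_∣; _/_; _<_; _≤_; positive; toℚᵘ)
open import Data.Rational.Properties
import Data.Rational.Unnormalised as ℚᵘ
import Data.Rational.Unnormalised.Properties as ℚᵘ
open import Algebra.Properties.CommutativeSemigroup
  (CommutativeMonoid.commutativeSemigroup +-0-commutativeMonoid) using (interchange)

-- Signs of reals, and threshold functions as nested matrices.

½+½ : ∀ ε → ½ * ε + ½ * ε ≡ ε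
½+½ ε = trans (sym (*-distribʳ-+ ε ½ ½)) (*-identityˡ ε)

0<½* : ∀ {ε} → 0ℚ < ε → 0ℚ < ½ * ε
0<½* {ε} 0<ε = positive⁻¹ (½ * ε) {{pos*pos⇒pos ½ ε {{positive 0<ε}}}}

p-q+q≡p : ∀ p q → p - q + q ≡ p
p-q+q≡p p q = trans (+-assoc p (- q) q) (trans (cong (_+_ p) (+-inverseˡ q)) (+-identityʳ p))

p≤∣p∣ : ∀ p → p ≤ ∣ p ∣
p≤∣p∣ p with ≤-total 0ℚ p
... | inj₁ 0≤p = ≤-reflexive (sym (0≤p⇒∣p∣≡p 0≤p))
... | inj₂ p≤0 = ≤-trans p≤0 (0≤∣p∣ p)

-- Past the Cauchy index for ε/2, a single term that is at least ε would keep all later terms above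
-- ε/2 and make x positive. Only rationals are compared, so the case split is decidable.
eventually-below : ∀ x → ¬ (0<ℝ x) → ∀ ε → 0ℚ < ε → ∃[ N ] (∀ n → N ℕ.≤ n → seq x n < ε)
eventually-below x x≯0 ε 0<ε with cauchy x (½ * ε) (0<½* 0<ε)
... | N , close = N , below
  where
  below : ∀ n → N ℕ.≤ n → seq x n < ε
  below n N≤n with seq x n <? ε
  ... | yes xn<ε = xn<ε
  ... | no  xn≮ε = contradiction (½ * ε , 0<½* 0<ε , N , above) x≯0
    where
    above : ∀ m → N ℕ.≤ m → ½ * ε < seq x m
    above m N≤m with ½ * ε <? seq x m
    ... | yes <xm = <xm
    ... | no  ≮xm = contradiction (begin-strict
      seq x n                        ≡⟨ p-q+q≡p (seq x n) (seq x m) ⟨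
      seq x n - seq x m + seq x m    <⟨ +-mono-<-≤ (≤-<-trans (p≤∣p∣ _) (close n m N≤n N≤m)) (≮⇒≥ ≮xm) ⟩
      ½ * ε + ½ * ε                  ≡⟨ ½+½ ε ⟩
      ε                              ∎) xn≮ε
      where open ≤-Reasoning

-- At one late index k the left side exceeds ε, a lower bound for x, because y is positive there;
-- the right side is below ε/2 + ε/2.
positive-sum : ∀ x y u v → (∀ k → seq x k + seq y k ≡ seq u k + seq v k) →
               0<ℝ x → 0<ℝ y → ¬ (0<ℝ u) → ¬ (0<ℝ v) → ⊥
positive-sum x y u v eq (ε , 0<ε , X , ε<x) (δ , 0<δ , Y , δ<y) u≯0 v≯0
  with eventually-below u u≯0 (½ * ε) (0<½* 0<ε) | eventually-below v v≯0 (½ * ε) (0<½* 0<ε)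
... | U , u< | V , v< = <-irrefl refl (begin-strict
  ε                    ≡⟨ +-identityʳ ε ⟨
  ε + 0ℚ               <⟨ +-mono-< (ε<x k X≤k) (<-trans 0<δ (δ<y k Y≤k)) ⟩
  seq x k + seq y k    ≡⟨ eq k ⟩
  seq u k + seq v k    <⟨ +-mono-< (u< k U≤k) (v< k V≤k) ⟩
  ½ * ε + ½ * ε        ≡⟨ ½+½ ε ⟩
  ε                    ∎)
  where
  open ≤-Reasoning
  k : ℕ
  k = (X ℕ.⊔ Y) ℕ.⊔ (U ℕ.⊔ V)
  X≤k : X ℕ.≤ k
  X≤k = ℕ.≤-trans (ℕ.m≤m⊔n X Y) (ℕ.m≤m⊔n (X ℕ.⊔ Y) (U ℕ.⊔ V))
  Y≤k : Y ℕ.≤ k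
  Y≤k = ℕ.≤-trans (ℕ.m≤n⊔m X Y) (ℕ.m≤m⊔n (X ℕ.⊔ Y) (U ℕ.⊔ V))
  U≤k : U ℕ.≤ k
  U≤k = ℕ.≤-trans (ℕ.m≤m⊔n U V) (ℕ.m≤n⊔m (X ℕ.⊔ Y) (U ℕ.⊔ V))
  V≤k : V ℕ.≤ k
  V≤k = ℕ.≤-trans (ℕ.m≤n⊔m U V) (ℕ.m≤n⊔m (X ℕ.⊔ Y) (U ℕ.⊔ V))

weighted : ∀ {N} → Vec ℝ N → Vec Bool N → ℝ
weighted w z = foldr′ _+ℝ_ (fromℚ 0ℚ) (zipWith _·_ w z)

-- The sum splits into a part from the first block and a part from the second, so swapping y and y′
-- only rearranges it. The identity holds term by term in the sequences.
weighted-exchange : ∀ {m n} (w : Vec ℝ (m ℕ.+ n)) (x x′ : Vec Bool m) (y y′ : Vec Bool n) k →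
  seq (weighted w (x ++ y)) k + seq (weighted w (x′ ++ y′)) k ≡
  seq (weighted w (x ++ y′)) k + seq (weighted w (x′ ++ y)) k
weighted-exchange w [] [] y y′ k = +-comm (seq (weighted w y) k) _
weighted-exchange (w ∷ ws) (b ∷ x) (b′ ∷ x′) y y′ k =
  trans (interchange (seq (w · b) k) _ _ _)
  (trans (cong (_+_ (seq (w · b) k + seq (w · b′) k)) (weighted-exchange ws x x′ y y′ k))
         (interchange (seq (w · b) k) _ _ _))

affine-exchange : ∀ {m n} w₀ (w : Vec ℝ (m ℕ.+ n)) (x x′ : Vec Bool m) (y y′ : Vec Bool n) k →
  seq (affine w₀ w (x ++ y)) k + seq (affine w₀ w (x′ ++ y′)) k ≡
  seq (affine w₀ w (x ++ y′)) k + seq (affine w₀ w (x′ ++ y)) k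
affine-exchange w₀ w x x′ y y′ k =
  trans (interchange (seq w₀ k) _ _ _)
  (trans (cong (_+_ (seq w₀ k + seq w₀ k)) (weighted-exchange w x x′ y y′ k))
         (interchange (seq w₀ k) _ _ _))

-- In a forbidden 2×2 pattern both diagonals have the same total affine value, yet one consists of
-- positive values and the other of non-positive ones.
LTF-ferrers : ∀ n (L : LTF (n ℕ.+ n)) → Ferrers (λ x y → eval L (x ++ y))
LTF-ferrers n L x x′ y y′ xy x′y′ xy′ x′y with isLTF L
... | w₀ , w , sign =
  positive-sum (a x y) (a x′ y′) (a x y′) (a x′ y) (affine-exchange w₀ w x x′ y y′)
    (signIs x y xy) (signIs x′ y′ x′y′) (signIs x y′ xy′) (signIs x′ y x′y)
  where
  a : Vec Bool n → Vec Bool n → ℝ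
  a x y = affine w₀ w (x ++ y)
  signIs : ∀ x y {b} → eval L (x ++ y) ≡ b → SignIs (a x y) b
  signIs x y refl = sign (x ++ y)

-- Fractions: the majority threshold and rational powers of 2.

-- `_/_` reduces to lowest terms, which hides numerator and denominator; passing to unnormalised
-- rationals recovers them up to equivalence.
toℚᵘ-/ : ∀ i d → toℚᵘ (i / suc d) ℚᵘ.≃ ℚᵘ.mkℚᵘ i d
toℚᵘ-/ i d = toℚᵘ-fromℚᵘ (ℚᵘ.mkℚᵘ i d)

signℚ-true : ∀ p q → signℚ (p - q) ≡ true → q ≤ p
signℚ-true p q eq = begin
  q          ≡⟨ +-identityˡ q ⟨
  0ℚ + q     ≤⟨ +-monoˡ-≤ q (<⇒≤ (⌊⌋-true (0ℚ <? (p - q)) eq)) ⟩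
  p - q + q  ≡⟨ p-q+q≡p p q ⟩
  p          ∎
  where open ≤-Reasoning

signℚ-false : ∀ p q → signℚ (p - q) ≡ false → p ≤ q
signℚ-false p q eq = begin
  p          ≡⟨ p-q+q≡p p q ⟨
  p - q + q  ≤⟨ +-monoˡ-≤ q (≮⇒≥ (⌊⌋-false (0ℚ <? (p - q)) eq)) ⟩
  0ℚ + q     ≡⟨ +-identityˡ q ⟩
  q          ∎
  where open ≤-Reasoning

/-≤⇒cross : ∀ a b c d → + a / suc b ≤ + c / suc d → a ℕ.* suc d ℕ.≤ c ℕ.* suc b
/-≤⇒cross a b c d a/b≤c/d with
  ℚᵘ.≤-respˡ-≃ (toℚᵘ-/ (+ a) b) (ℚᵘ.≤-respʳ-≃ (toℚᵘ-/ (+ c) d) (toℚᵘ-mono-≤ a/b≤c/d))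
... | ℚᵘ.*≤* le = ℤ.drop‿+≤+ (subst₂ ℤ._≤_ (sym (ℤ.pos-* a (suc d))) (sym (ℤ.pos-* c (suc b))) le)

k*2≡k+k : ∀ k → k ℕ.* 2 ≡ k ℕ.+ k
k*2≡k+k k = trans (ℕ.*-comm k 2) (cong (k ℕ.+_) (ℕ.+-identityʳ k))

sign-half-true : ∀ k n → signℚ (+ k / 1 - + n / 2) ≡ true → n ℕ.≤ k ℕ.+ k
sign-half-true k n eq = subst₂ ℕ._≤_ (ℕ.*-identityʳ n) (k*2≡k+k k)
  (/-≤⇒cross n 1 k 0 (signℚ-true (+ k / 1) (+ n / 2) eq))

sign-half-false : ∀ k n → signℚ (+ k / 1 - + n / 2) ≡ false → k ℕ.+ k ℕ.≤ n
sign-half-false k n eq = subst₂ ℕ._≤_ (k*2≡k+k k) (ℕ.*-identityʳ n)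
  (/-≤⇒cross k 0 n 1 (signℚ-false (+ k / 1) (+ n / 2) eq))

^-cancelʳ-≤ : ∀ a b k .{{_ : ℕ.NonZero k}} → a ℕ.^ k ℕ.≤ b ℕ.^ k → a ℕ.≤ b
^-cancelʳ-≤ a b k aᵏ≤bᵏ = ℕ.≮⇒≥ λ b<a → ℕ.<⇒≱ (ℕ.^-monoˡ-< k b<a) aᵏ≤bᵏ

-- The relation `2^_≤_` reads r in lowest terms, p / (e + 1), whereas the bound is known for n / (d
-- + 1). Raising to the powers e + 1 and d + 1 makes the exponents agree by cross-multiplication,
-- and a root is taken at the end.
2^-≤ : ∀ r n d m → toℚᵘ r ℚᵘ.≃ ℚᵘ.mkℚᵘ (+ n) d → 2 ℕ.^ n ℕ.≤ m ℕ.^ suc d → 2^ r ≤ m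
2^-≤ (mkℚ (+ p) e _) n d m (ℚᵘ.*≡* eq) 2ⁿ≤ = ^-cancelʳ-≤ _ _ (suc d) (begin
  (2 ℕ.^ p) ℕ.^ suc d      ≡⟨ ℕ.^-*-assoc 2 p (suc d) ⟩
  2 ℕ.^ (p ℕ.* suc d)      ≡⟨ cong (2 ℕ.^_) cross ⟩
  2 ℕ.^ (n ℕ.* suc e)      ≡⟨ ℕ.^-*-assoc 2 n (suc e) ⟨
  (2 ℕ.^ n) ℕ.^ suc e      ≤⟨ ℕ.^-monoˡ-≤ (suc e) 2ⁿ≤ ⟩
  (m ℕ.^ suc d) ℕ.^ suc e  ≡⟨ ℕ.^-*-assoc m (suc d) (suc e) ⟩
  m ℕ.^ (suc d ℕ.* suc e)  ≡⟨ cong (m ℕ.^_) (ℕ.*-comm (suc d) (suc e)) ⟩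
  m ℕ.^ (suc e ℕ.* suc d)  ≡⟨ ℕ.^-*-assoc m (suc e) (suc d) ⟨
  (m ℕ.^ suc e) ℕ.^ suc d  ∎)
  where
  open ℕ.≤-Reasoning
  cross : p ℕ.* suc d ≡ n ℕ.* suc e
  cross = ℤ.+-injective (trans (ℤ.pos-* p (suc d)) (trans eq (sym (ℤ.pos-* n (suc e)))))
2^-≤ (mkℚ -[1+ p ] e _) n d m (ℚᵘ.*≡* eq) _ =
  contradiction (trans eq (sym (ℤ.pos-* n (suc e)))) λ ()

⅛n : ∀ n → toℚᵘ (+ 1 / 8 * (+ n / 1)) ℚᵘ.≃ ℚᵘ.mkℚᵘ (+ n) 7
⅛n n = begin
  toℚᵘ (+ 1 / 8 * (+ n / 1))          ≈⟨ toℚᵘ-homo-* (+ 1 / 8) (+ n / 1) ⟩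
  toℚᵘ (+ 1 / 8) ℚᵘ.* toℚᵘ (+ n / 1)  ≈⟨ ℚᵘ.*-congˡ {ℚᵘ.mkℚᵘ (+ 1) 7} (toℚᵘ-/ (+ n) 0) ⟩
  ℚᵘ.mkℚᵘ (+ 1 ℤ.* + n) 7             ≡⟨ cong (λ i → ℚᵘ.mkℚᵘ i 7) (ℤ.*-identityˡ (+ n)) ⟩
  ℚᵘ.mkℚᵘ (+ n) 7                     ∎
  where open import Relation.Binary.Reasoning.Setoid ℚᵘ.≃-setoid

-- Decision lists and the final bound.

joined-++ : ∀ (F : Vec Bool n → Vec Bool n → Bool) x y → joined F (x ++ y) ≡ F x y
joined-++ {n} F x y with ++-injective (take n (x ++ y)) x (take++drop≡id n (x ++ y))
... | take≡ , drop≡ = cong₂ F take≡ drop≡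

-- Identifies the index supplied by `Computes` with the one found for the rectangle.
FirstTrue-unique : ∀ {N} (D : LinearDecisionList N) x {i j} →
                   FirstTrue D x i → FirstTrue D x j → i ≡ j
FirstTrue-unique D x {i} {j} (i-true , before-i) (j-true , before-j) with Fin.<-cmp i j
... | tri< i<j _ _ = contradiction (trans (sym i-true) (before-j i i<j)) λ ()
... | tri≈ _ i≡j _ = i≡j
... | tri> _ _ j<i = contradiction (trans (sym j-true) (before-i j j<i)) λ ()

MonochromaticRectangle : ∀ n → ℕ → (Vec Bool (n +ℕ n) → Bool) → Set
MonochromaticRectangle n k f =
  Σ[ b ∈ Bool ] Σ[ A ∈ Subset n ] Σ[ B ∈ Subset n ]
    (2 ℕ.^ n ℕ.≤ k ℕ.* count A × 2 ℕ.^ n ℕ.≤ k ℕ.* count B ×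
     Constant (λ x y → f (x ++ y)) b A B)

monochromatic-rectangle : ∀ n (D : LinearDecisionList (n +ℕ n)) f → Computes D f →
                          MonochromaticRectangle n (size D) f
monochromatic-rectangle n D f computes =
  conclude (first-query-rectangle (size-1 D) M (λ i → LTF-ferrers n (query D i))
    (λ x y → last-const D (x ++ y)) (size D) (2 ℕ.^ n) (λ _ → true) (λ _ → true) full full)
  where
  M : Fin (size D) → Matrix n
  M i x y = eval (query D i) (x ++ y)
  -- With k the size and N = 2ⁿ, the full cube meets the requirement of `first-query-rectangle`
  -- exactly.
  full : size D ℕ.* 2 ℕ.^ n ℕ.≤ size D ℕ.* count {n} (λ _ → true)
  full = ℕ.≤-reflexive (cong (size D ℕ.*_) (sym (count-full n)))
  conclude : FirstQueryRectangle (size-1 D) M (size D) (2 ℕ.^ n) (λ _ → true) (λ _ → true) →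
             MonochromaticRectangle n (size D) f
  conclude (i , A , B , _ , _ , A-big , B-big , ones , earlier) =
    answer D i , A , B , A-big , B-big , constant
    where
    constant : Constant (λ x y → f (x ++ y)) (answer D i) A B
    constant x y x∈ y∈ with computes (x ++ y)
    ... | _ , first , value≡ =
      trans value≡ (cong (answer D) (FirstTrue-unique D (x ++ y) first
        (ones x y x∈ y∈ , λ j j<i → earlier j j<i x y x∈ y∈)))

monochromatic-bound : ∀ n k → MonochromaticRectangle n k (joined (MAJ n ∘XOR)) →
                      2 ℕ.^ n ℕ.≤ k ℕ.^ 8
monochromatic-bound n k (true , A , B , A-big , B-big , constant) =
  far-rectangle-bound n k A B A-big B-big λ x y x∈ y∈ →
    sign-half-true (dist x y) n
      (trans (sym (joined-++ (MAJ n ∘XOR) x y)) (constant x y x∈ y∈))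
monochromatic-bound n k (false , A , B , A-big , B-big , constant) =
  near-rectangle-bound n k A B A-big B-big λ x y x∈ y∈ →
    sign-half-false (dist x y) n
      (trans (sym (joined-++ (MAJ n ∘XOR) x y)) (constant x y x∈ y∈))

theorem1 : ∃[ c ] (0ℚ < c × ∃[ n₀ ] (∀ n → n ≥ n₀ →
    (D : LinearDecisionList (n +ℕ n)) →
    Computes D (joined (MAJ n ∘XOR)) →
    2^ (c * ((+ n) / 1)) ≤ size D))
-- The bound 2ⁿ ≤ k⁸ says 2^(n/8) ≤ k and holds for all n, so c = 1/8 and n₀ = 0.
theorem1 = + 1 / 8 , positive⁻¹ (+ 1 / 8) , 0 , λ n _ D computes →
  2^-≤ (+ 1 / 8 * (+ n / 1)) n 7 (size D) (⅛n n) (monochromatic-bound n (size D)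
    (monochromatic-rectangle n D (joined (MAJ n ∘XOR)) computes))
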